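{- If a Collatz trajectory $(n,C(n),C^2(n),\dots)$, $n\in\mathbb{N}^+$, does not contain $1$, then for every $r\in\{2,3,4,6\}$ it contains some element congruent to $r$ modulo $8$.
   Context: $C:\mathbb{N}^+\to\mathbb{N}^+$ is the Collatz function $C(n)=n/2$ for $n$ even and $C(n)=3n+1$ for $n$ odd. -}

module Defs where

open import Data.Nat.Base using (ℕ; NonZero; >-nonZero; _+_; _*_; _/_; _%_)
open import Data.Nat.DivMod using (m≥n⇒m/n>0)
open import Data.Nat.Divisibility using (_∣?_; ∣⇒≤)
open import Data.Nat.GeneralisedArithmetic using (iterate)
open import Data.Nat.Properties using (m≤n+m)
open import Data.Product.Base using (∃-syntax)
open import Relation.Binary.PropositionalEquality.Core using (_≡_)
open import Relation.Nullary using (yes; no)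

-- Totalised to ℕ (with C 0 = 0); C-nonZero shows that it restricts to the
-- Collatz function on the positive integers.
C : ℕ → ℕ
C n with 2 ∣? n
... | yes _ = n / 2
... | no  _ = 3 * n + 1

C-nonZero : ∀ n .{{_ : NonZero n}} → NonZero (C n)
C-nonZero n with 2 ∣? n
... | yes 2∣n = >-nonZero (m≥n⇒m/n>0 (∣⇒≤ 2∣n))
... | no  _   = >-nonZero (m≤n+m 1 (3 * n))

infix 4 _∈Trajectory_ _≡_[mod8]

_∈Trajectory_ : ℕ → ℕ → Set
m ∈Trajectory n = ∃[ k ] iterate C n k ≡ m

_≡_[mod8] : ℕ → ℕ → Set
a ≡ b [mod8] = a % 8 ≡ b % 8

{-# OPTIONS --safe #-}

-- An element n ≡ 3 mod 4 can only be preceded by 2n ≡ 6 mod 8.  So, as long as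
-- a trajectory avoids the residue 6, its odd elements after the initial one have
-- the form 1 + 4m, and such an element leads to 1 + 3m, which is smaller unless
-- m = 0.  Hence every trajectory meets 1 or the residue 6.
-- From 6 it enters the residue class 3 mod 4; there two steps turn n + 1 = 8t
-- into 12t, so the power of 2 dividing n + 1 drops until n ≡ 3 mod 8.
-- Finally 3 is followed by 2, and 2 by 1, 4 or by 5, 0, …, 0, 4.
module Submission where

open import Defs
open import Data.Fin.Base using (zero; suc)
open import Data.List.Base using ([]; _∷_)
open import Data.List.Membership.Propositional using (_∈_)
open import Data.List.Relation.Unary.Any using (here; there)
open import Data.Nat.Base using (ℕ; zero; suc; NonZero; _+_; _*_; _%_; _/_; _<_)
open import Data.Nat.DivMod using (_divMod_; result; m*n/n≡m; m≡m%n+[m/n]*n; [m+kn]%n≡m%n)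
open import Data.Nat.Divisibility using (_∣_; _∣?_; divides-refl; ∣m+n∣m⇒∣n; ∣1⇒≡1)
open import Data.Nat.Induction using (Acc; acc; <-wellFounded)
open import Data.Nat.Properties using (+-comm; m≤m+n; m<m*n; suc-injective)
open import Data.Nat.Tactic.RingSolver using (solve-∀)
open import Data.Product.Base using (∃-syntax; _×_; _,_)
open import Data.Sum.Base using (_⊎_; inj₁; inj₂)
open import Level using (0ℓ)
open import Relation.Binary.PropositionalEquality using (_≡_; refl; sym; trans; cong; subst)
open import Relation.Nullary using (¬_; yes; no; contradiction)
open import Relation.Unary using (Pred)

C-even : ∀ m → C (m * 2) ≡ m
C-even m with 2 ∣? (m * 2)
... | yes _  = m*n/n≡m m 2
... | no 2∤n = contradiction (divides-refl m) 2∤n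

-- The value is stated as a double, ready for `C-even` in the next step.
C-odd : ∀ m → C (1 + m * 2) ≡ (2 + m * 3) * 2
C-odd m with 2 ∣? (1 + m * 2)
... | yes 2∣n =
  contradiction (∣1⇒≡1 (∣m+n∣m⇒∣n (subst (2 ∣_) (+-comm 1 (m * 2)) 2∣n) (divides-refl m))) λ ()
... | no _ = eq m
  where
  eq : ∀ m → 3 * (1 + m * 2) + 1 ≡ (2 + m * 3) * 2
  eq = solve-∀

Meets : Pred ℕ 0ℓ → Pred ℕ 0ℓ
Meets P n = ∃[ m ] (m ∈Trajectory n × P m)

module _ {P : Pred ℕ 0ℓ} where

  now : ∀ {n} → P n → Meets P n
  now p = _ , (0 , refl) , p

  later : ∀ {n} → Meets P (C n) → Meets P n
  later (m , (k , eq) , p) = m , (suc k , eq) , p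

  -- The equation leaves `n` in whatever arithmetic form the caller has.
  halve : ∀ m {n} → n ≡ m * 2 → Meets P m → Meets P n
  halve m refl w = later (subst (Meets P) (sym (C-even m)) w)

  triple : ∀ m {n} → n ≡ 1 + m * 2 → Meets P ((2 + m * 3) * 2) → Meets P n
  triple m refl w = later (subst (Meets P) (sym (C-odd m)) w)

  triple-halve : ∀ m {n} → n ≡ 1 + m * 2 → Meets P (2 + m * 3) → Meets P n
  triple-halve m eq w = triple m eq (halve (2 + m * 3) refl w)

∈Trajectory-trans : ∀ {l m} n → m ∈Trajectory n → l ∈Trajectory m → l ∈Trajectory n
∈Trajectory-trans n (zero , refl)  l∈m = l∈m
∈Trajectory-trans n (suc k , refl) l∈m with ∈Trajectory-trans (C n) (k , refl) l∈m
... | j , eq = suc j , eq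

Meets-bind : ∀ {P Q n} → Meets P n → (∀ {m} → P m → Meets Q m) → Meets Q n
Meets-bind {n = n} (_ , m∈n , p) f with f p
... | l , l∈m , q = l , ∈Trajectory-trans n m∈n l∈m , q

Residue : ℕ → Pred ℕ 0ℓ
Residue r m = m ≡ r [mod8]

residue : ∀ r q {n} → n ≡ r + q * 8 → Residue r n
residue r q refl = [m+kn]%n≡m%n r q 8

residue⇒≡ : ∀ r {n} → Residue r n → n ≡ r % 8 + n / 8 * 8
residue⇒≡ r {n} eq = trans (m≡m%n+[m/n]*n n 8) (cong (_+ n / 8 * 8) eq)

OneOrSix : Pred ℕ 0ℓ
OneOrSix m = m ≡ 1 ⊎ Residue 6 m

-- `suc m` leaves out 0, whose trajectory stays at 0 and so meets neither 1 nor the residue 6.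
data NotThreeMod4 : Pred ℕ 0ℓ where
  even : ∀ m → NotThreeMod4 (suc m * 2)
  one  : ∀ m → NotThreeMod4 (1 + m * 4)

-- Strict descent from an odd element over three steps; without `suc` it would fail at the element
-- 1.
1+3m<1+4m : ∀ m → 1 + suc m * 3 < 1 + suc m * 4
1+3m<1+4m m = subst (1 + suc m * 3 <_) (eq m) (m≤m+n _ m)
  where
  eq : ∀ m → 2 + suc m * 3 + m ≡ 1 + suc m * 4
  eq = solve-∀

-- Strong induction. Except at 1, the trajectory reaches a double 2x with x below the start. If x is
-- 3 mod 4, then 2x is 6 mod 8; otherwise x is again in the class.
notThreeMod4-meets : ∀ {n} → Acc _<_ n → NotThreeMod4 n → Meets OneOrSix n
notThreeMod4-meets (acc rs) (even m) = go m (rs (m<m*n (suc m) 2 (m≤m+n 2 0)))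
  where
  go : ∀ m → Acc _<_ (suc m) → Meets OneOrSix (suc m * 2)
  -- The half is `suc m`, so it is 3 mod 4 exactly for remainder 2 of `m`.
  go m a with m divMod 4
  ... | result q zero refl =
    halve (1 + q * 4) refl (notThreeMod4-meets a (one q))
  ... | result q (suc zero) refl =
    halve (2 + q * 4) refl (notThreeMod4-meets a (subst NotThreeMod4 (eq q) (even (q * 2))))
    where
    eq : ∀ q → suc (q * 2) * 2 ≡ 2 + q * 4
    eq = solve-∀
  ... | result q (suc (suc zero)) refl = now (inj₂ (residue 6 q (eq q)))
    where
    eq : ∀ q → (3 + q * 4) * 2 ≡ 6 + q * 8
    eq = solve-∀
  ... | result q (suc (suc (suc zero))) refl =
    halve (4 + q * 4) refl (notThreeMod4-meets a (subst NotThreeMod4 (eq q) (even (1 + q * 2))))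
    where
    eq : ∀ q → suc (1 + q * 2) * 2 ≡ 4 + q * 4
    eq = solve-∀
notThreeMod4-meets _ (one zero) = now (inj₁ refl)
notThreeMod4-meets (acc rs) (one (suc m)) =
  triple-halve (suc m * 2) (eq₁ m) (go m (rs (1+3m<1+4m m)))
  where
  eq₁ : ∀ m → 1 + suc m * 4 ≡ 1 + suc m * 2 * 2
  eq₁ = solve-∀
  eq₂ : ∀ m → 2 + suc m * 2 * 3 ≡ (1 + suc m * 3) * 2
  eq₂ = solve-∀
  go : ∀ m → Acc _<_ (1 + suc m * 3) → Meets OneOrSix (2 + suc m * 2 * 3)
  -- The half `1 + suc m * 3` is congruent to `3 * m` mod 4, hence 3 mod 4 exactly for remainder 1.
  go m a with m divMod 4
  ... | result q zero refl = halve (1 + (1 + q * 4) * 3) (eq₂ (q * 4))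
    (notThreeMod4-meets a (subst NotThreeMod4 (eq q) (even (1 + q * 6))))
    where
    eq : ∀ q → suc (1 + q * 6) * 2 ≡ 1 + (1 + q * 4) * 3
    eq = solve-∀
  ... | result q (suc zero) refl = now (inj₂ (residue 6 (1 + q * 3) (eq q)))
    where
    eq : ∀ q → 2 + (2 + q * 4) * 2 * 3 ≡ 6 + (1 + q * 3) * 8
    eq = solve-∀
  ... | result q (suc (suc zero)) refl = halve (1 + (3 + q * 4) * 3) (eq₂ (2 + q * 4))
    (notThreeMod4-meets a (subst NotThreeMod4 (eq q) (even (4 + q * 6))))
    where
    eq : ∀ q → suc (4 + q * 6) * 2 ≡ 1 + (3 + q * 4) * 3
    eq = solve-∀
  ... | result q (suc (suc (suc zero))) refl = halve (1 + (4 + q * 4) * 3) (eq₂ (3 + q * 4))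
    (notThreeMod4-meets a (subst NotThreeMod4 (eq q) (one (3 + q * 3))))
    where
    eq : ∀ q → 1 + (3 + q * 3) * 4 ≡ 1 + (4 + q * 4) * 3
    eq = solve-∀

meets-1-or-6 : ∀ n → Meets OneOrSix (suc n)
meets-1-or-6 n with n divMod 4
... | result q zero refl = notThreeMod4-meets (<-wellFounded _) (one q)
... | result q (suc zero) refl =
  notThreeMod4-meets (<-wellFounded _) (subst NotThreeMod4 (eq q) (even (q * 2)))
  where
  eq : ∀ q → suc (q * 2) * 2 ≡ 2 + q * 4
  eq = solve-∀
... | result q (suc (suc (suc zero))) refl =
  notThreeMod4-meets (<-wellFounded _) (subst NotThreeMod4 (eq q) (even (1 + q * 2)))
  where
  eq : ∀ q → suc (1 + q * 2) * 2 ≡ 4 + q * 4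
  eq = solve-∀
-- An initial element 3 mod 4 lies outside the class: 3 mod 8 goes to 1 mod 4 in two steps, 7 mod 8
-- to 6 mod 8 in one.
... | result q (suc (suc zero)) refl with q divMod 2
...   | result s zero refl =
  triple-halve (1 + s * 4) (eq₁ s)
    (notThreeMod4-meets (<-wellFounded _) (subst NotThreeMod4 (eq₂ s) (one (1 + s * 3))))
  where
  eq₁ : ∀ s → 3 + s * 2 * 4 ≡ 1 + (1 + s * 4) * 2
  eq₁ = solve-∀
  eq₂ : ∀ s → 1 + (1 + s * 3) * 4 ≡ 2 + (1 + s * 4) * 3
  eq₂ = solve-∀
...   | result s (suc zero) refl =
  triple (3 + s * 4) (eq₁ s) (now (inj₂ (residue 6 (2 + s * 3) (eq₂ s))))
  where
  eq₁ : ∀ s → 3 + (1 + s * 2) * 4 ≡ 1 + (3 + s * 4) * 2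
  eq₁ = solve-∀
  eq₂ : ∀ s → (2 + (3 + s * 4) * 3) * 2 ≡ 6 + (2 + s * 3) * 8
  eq₂ = solve-∀

-- The right side is `suc m * 2` in the form that `divMod` leaves; it is the descent for stripping
-- factors of 2.
suc-m<suc-1+m*2 : ∀ m → suc m < suc (1 + m * 2)
suc-m<suc-1+m*2 m = m<m*n (suc m) 2 (m≤m+n 2 0)

-- The odd factor 1 + 2e collects the powers of 3, so that suc t alone carries
-- the power of 2 dividing n + 1.
threeMod4-meets-3 : ∀ e t {n} → Acc _<_ (suc t) →
                    suc n ≡ (1 + e * 2) * suc t * 4 → Meets (Residue 3) n
threeMod4-meets-3 e t (acc rs) n+1≡ with t divMod 2
... | result s zero refl =
  now (residue 3 (e + s + e * s * 2) (suc-injective (trans n+1≡ (eq e s))))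
  where
  eq : ∀ e s → (1 + e * 2) * suc (s * 2) * 4 ≡ suc (3 + (e + s + e * s * 2) * 8)
  eq = solve-∀
-- The new factor 3 joins the odd part: 3(1 + 2e) = 1 + 2(1 + 3e).
... | result s (suc zero) refl =
  triple-halve (3 + x * 4) (suc-injective (trans n+1≡ (eq₁ e s)))
    (threeMod4-meets-3 (1 + e * 3) s (rs (suc-m<suc-1+m*2 s)) (eq₂ e s))
  where
  -- Chosen so that `suc x` is `(1 + e * 2) * suc s`, an eighth of n + 1.
  x = s + e * suc s * 2
  eq₁ : ∀ e s → (1 + e * 2) * suc (1 + s * 2) * 4 ≡ suc (1 + (3 + (s + e * suc s * 2) * 4) * 2)
  eq₁ = solve-∀
  eq₂ : ∀ e s → suc (2 + (3 + (s + e * suc s * 2) * 4) * 3) ≡ (1 + (1 + e * 3) * 2) * suc s * 4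
  eq₂ = solve-∀

6-meets-3 : ∀ {n} → Residue 6 n → Meets (Residue 3) n
6-meets-3 {n} n≡6 =
  halve (3 + q * 4) (trans (residue⇒≡ 6 n≡6) (eq₁ q))
    -- No power of 3 has been collected yet, so the odd factor starts at 1.
    (threeMod4-meets-3 0 q (<-wellFounded _) (eq₂ q))
  where
  q = n / 8
  eq₁ : ∀ q → 6 + q * 8 ≡ (3 + q * 4) * 2
  eq₁ = solve-∀
  eq₂ : ∀ q → suc (3 + q * 4) ≡ (1 + 0 * 2) * suc q * 4
  eq₂ = solve-∀

3-meets-2 : ∀ {n} → Residue 3 n → Meets (Residue 2) n
3-meets-2 {n} n≡3 =
  triple (1 + q * 4) (trans (residue⇒≡ 3 n≡3) (eq₁ q)) (now (residue 2 (1 + q * 3) (eq₂ q)))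
  where
  q = n / 8
  eq₁ : ∀ q → 3 + q * 8 ≡ 1 + (1 + q * 4) * 2
  eq₁ = solve-∀
  eq₂ : ∀ q → (2 + (1 + q * 4) * 3) * 2 ≡ 2 + (1 + q * 3) * 8
  eq₂ = solve-∀

-- Halving strips factors of 2 until 8 times an odd number is left, whose half is 4 mod 8.
multipleOf8-meets-4 : ∀ m → Acc _<_ (suc m) → Meets (Residue 4) (suc m * 8)
multipleOf8-meets-4 m (acc rs) with m divMod 2
... | result s zero refl = halve (4 + s * 8) (eq s) (now (residue 4 s refl))
  where
  eq : ∀ s → suc (s * 2) * 8 ≡ (4 + s * 8) * 2
  eq = solve-∀
... | result s (suc zero) refl =
  halve (suc s * 8) (eq s) (multipleOf8-meets-4 s (rs (suc-m<suc-1+m*2 s)))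
  where
  eq : ∀ s → suc (1 + s * 2) * 8 ≡ suc s * 8 * 2
  eq = solve-∀

2-meets-4 : ∀ {n} → Residue 2 n → Meets (Residue 4) n
2-meets-4 {n} n≡2 = halve (1 + q * 4) (trans (residue⇒≡ 2 n≡2) (eq q)) (go q)
  where
  q = n / 8
  eq : ∀ q → 2 + q * 8 ≡ (1 + q * 4) * 2
  eq = solve-∀
  go : ∀ q → Meets (Residue 4) (1 + q * 4)
  go q with q divMod 2
  ... | result s zero refl =
    triple (s * 4) (eq₁ s) (now (residue 4 (s * 3) (eq₂ s)))
    where
    eq₁ : ∀ s → 1 + s * 2 * 4 ≡ 1 + s * 4 * 2
    eq₁ = solve-∀
    eq₂ : ∀ s → (2 + s * 4 * 3) * 2 ≡ 4 + s * 3 * 8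
    eq₂ = solve-∀
  -- Here 5 + 8s goes to 16 + 24s = 8(2 + 3s), a positive multiple of 8.
  ... | result s (suc zero) refl =
    triple (2 + s * 4) (eq₁ s)
      (subst (Meets (Residue 4)) (eq₂ s) (multipleOf8-meets-4 (1 + s * 3) (<-wellFounded _)))
    where
    eq₁ : ∀ s → 1 + (1 + s * 2) * 4 ≡ 1 + (2 + s * 4) * 2
    eq₁ = solve-∀
    eq₂ : ∀ s → suc (1 + s * 3) * 8 ≡ (2 + (2 + s * 4) * 3) * 2
    eq₂ = solve-∀

mainTheorem17 : (n : ℕ) .{{_ : NonZero n}} → ¬ (1 ∈Trajectory n) →
    (r : ℕ) → r ∈ (2 ∷ 3 ∷ 4 ∷ 6 ∷ []) →
    ∃[ m ] (m ∈Trajectory n × m ≡ r [mod8])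
mainTheorem17 (suc n) 1∉n = λ where
    r (here refl)                         → meets-2
    r (there (here refl))                 → meets-3
    r (there (there (here refl)))         → Meets-bind meets-2 2-meets-4
    r (there (there (there (here refl)))) → meets-6
  where
  meets-6 : Meets (Residue 6) (suc n)
  meets-6 with meets-1-or-6 n
  ... | _ , 1∈n , inj₁ refl = contradiction 1∈n 1∉n
  ... | m , m∈n , inj₂ m≡6  = m , m∈n , m≡6
  meets-3 : Meets (Residue 3) (suc n)
  meets-3 = Meets-bind meets-6 6-meets-3
  meets-2 : Meets (Residue 2) (suc n)
  meets-2 = Meets-bind meets-3 3-meets-2
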